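{- Let $k \geq 3$ and $m \geq 1$ be integers. Let $G$ be an edge-colored graph on $n \geq km$ vertices. If $$e(G)+c(G) \geq \binom{n-k(m-1)}{2} + \operatorname{rb}(K_{n-k(m-1)}, K_k) + k(m-1)(2n-1) - k^2(m-1)^2,$$ then $G$ contains $m$ (pairwise) vertex-disjoint rainbow $K_k$ subgraphs.
   Context: All graphs are finite and simple. An edge-colored graph is a graph $G$ together with an arbitrary map $C:E(G)\to\mathbb{N}$ (not necessarily a proper coloring). $e(G)=|E(G)|$ is the number of edges, and $c(G)=|C(E(G))|$ is the number of distinct colors appearing on the edges of $G$. An edge-colored graph is rainbow if no two of its edges share the same color. $K_n$ is the complete graph on $n$ vertices. A rainbow $K_k$ in $G$ is a subgraph of $G$ isomorphic to $K_k$ that is rainbow under the coloring of $G$. Subgraphs are vertex-disjoint if any two different ones have disjoint vertex sets (different subgraphs may share colors). For graphs $G,H$, $\operatorname{rb}(G,H)$ denotes the minimum number of colors such that every edge coloring of $G$ with at least $\operatorname{rb}(G,H)$ colors contains a rainbow $H$. -}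

module Defs where

open import Data.Fin using (Fin; _<_)
open import Data.Fin.Properties using (_≟_; _<?_)
open import Data.List using (List; allFin; cartesianProduct; deduplicate; length; map; mapMaybe)
open import Data.Maybe as Maybe using (Maybe)
open import Data.Nat using (ℕ; _≤_; _≥_)
import Data.Nat.Properties as ℕ
open import Data.Product using (Σ-syntax; _×_; _,_)
open import Data.Sum using (_⊎_)
open import Function.Definitions using (Injective)
open import Level using (0ℓ)
open import Relation.Binary using (Decidable; Irreflexive; Rel; Symmetric)
open import Relation.Binary.PropositionalEquality using (_≡_; _≢_; ≢-sym)
open import Relation.Nullary.Decidable using (¬?; _×-dec_; dec⇒maybe)

record Graph (n : ℕ) : Set₁ where
  field
    Adj    : Rel (Fin n) 0ℓ
    sym    : Symmetric Adj
    irrefl : Irreflexive _≡_ Adj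
    adj?   : Decidable Adj

open Graph public

K : ∀ n → Graph n
K n = record
  { Adj    = _≢_
  ; sym    = ≢-sym
  ; irrefl = λ u≡v u≢v → u≢v u≡v
  ; adj?   = λ u v → ¬? (u ≟ v)
  }

-- An unordered edge is represented once, with its smaller endpoint first.
Edge : ∀ {n} → Graph n → Set
Edge {n} G = Σ[ (u , v) ∈ Fin n × Fin n ] (u < v × Adj G u v)

edges : ∀ {n} (G : Graph n) → List (Edge G)
edges {n} G = mapMaybe edge? (cartesianProduct (allFin n) (allFin n))
  where
  edge? : Fin n × Fin n → Maybe (Edge G)
  edge? (u , v) = Maybe.map ((u , v) ,_) (dec⇒maybe (u <? v ×-dec adj? G u v))

e : ∀ {n} → Graph n → ℕ
e G = length (edges G)

-- A map E(G) → ℕ. The adjacency proof is irrelevant and the colour is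
-- symmetric in the endpoints, so it depends only on the unordered edge.
record Colouring {n} (G : Graph n) : Set where
  field
    colour     : ∀ u v → .(Adj G u v) → ℕ
    colour-sym : ∀ u v .(a : Adj G u v) → colour u v a ≡ colour v u (sym G a)

open Colouring public

edgeColour : ∀ {n} {G : Graph n} → Colouring G → Edge G → ℕ
edgeColour χ ((u , v) , _ , a) = colour χ u v a

c : ∀ {n} {G : Graph n} → Colouring G → ℕ
c {G = G} χ = length (deduplicate ℕ._≟_ (map (edgeColour χ) (edges G)))

-- A rainbow subgraph isomorphic to H, given by an embedding of H into G.
-- Subgraphs need not be induced.
record RainbowCopy {n h} {G : Graph n} (χ : Colouring G) (H : Graph h) : Set where
  field
    vertex    : Fin h → Fin n
    injective : Injective _≡_ _≡_ vertex
    edge      : ∀ {i j} → Adj H i j → Adj G (vertex i) (vertex j)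
    rainbow   : ∀ {i j i′ j′} (a : Adj H i j) (b : Adj H i′ j′) →
                colour χ (vertex i) (vertex j) (edge a) ≡
                colour χ (vertex i′) (vertex j′) (edge b) →
                (i ≡ i′ × j ≡ j′) ⊎ (i ≡ j′ × j ≡ i′)

open RainbowCopy public

VertexDisjoint : ∀ {n h h′} {G : Graph n} {χ : Colouring G} {H : Graph h} {H′ : Graph h′} →
                 RainbowCopy χ H → RainbowCopy χ H′ → Set
VertexDisjoint S T = ∀ i j → vertex S i ≢ vertex T j

ForcesRainbow : ∀ {n h} → Graph n → Graph h → ℕ → Set
ForcesRainbow G H r = (χ : Colouring G) → c χ ≥ r → RainbowCopy χ H

-- IsRb G H r says rb(G,H) = r. The minimum is taken over a nonempty set, as
-- every r > e(G) forces a rainbow H vacuously. It is kept as a relation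
-- because extracting a least element constructively would require deciding
-- ForcesRainbow G H r.
IsRb : ∀ {n h} → Graph n → Graph h → ℕ → Set
IsRb G H r = ForcesRainbow G H r × (∀ s → ForcesRainbow G H s → r ≤ s)

{-# OPTIONS --safe #-}
module Submission where

-- Call the weight of a vertex set the number of its edges plus the number of its
-- colours. Deleting s = k (m − 1) vertices from n lowers the weight by at most
-- s (2 n − 1) − s ², so the vertices of any m − 1 rainbow copies of K k can be
-- deleted, and it suffices to find one rainbow K k when the weight of N ≥ k
-- vertices is at least (N choose 2) + rb.
--
-- Explicit colourings bound rb from below: by N when k = 3, and by 2 plus the
-- number of edges of the Turán graph with p = k − 2 classes when k ≥ 4. Against
-- these bounds, induct on N. A vertex x can be deleted unless its degree plus the
-- number of colours occurring only at x is large. If no vertex can be deleted,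
-- draw an arc x ⇝ y for one edge xy of each colour that occurs only at x. The
-- digraph is so dense that vertices x₁, …, x_p can be chosen greedily, each with
-- arcs to all later ones and to both ends of some edge yz; these k vertices span
-- a rainbow clique, since the colours on the arcs from x_i do not occur among
-- the vertices after x_i.

open import Defs renaming (sym to Adj-sym)
open import Data.Fin as Fin using (Fin; zero; suc; fromℕ<; punchIn; toℕ)
open import Data.Fin.Patterns using (0F; 1F; 2F)
open import Data.Fin.Properties using (_≟_; _<?_; fromℕ<-injective; pigeonhole; punchIn-injective; punchInᵢ≢i; toℕ-fromℕ<)
  renaming (<-asym to <F-asym; <-irrefl to <F-irrefl; <⇒≢ to <F⇒≢)
open import Data.List using (List; []; _∷_; _++_; allFin; cartesianProduct; deduplicate; drop; filter; length; map; mapMaybe; tabulate; take; upTo)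
open import Data.List.Extrema.Nat using (argmax; argmax-all; f[⊥]≤f[argmax]; f[xs]≤f[argmax])
open import Data.List.Membership.DecPropositional using (_∈?_)
open import Data.List.Membership.Propositional using (_∈_; _∉_; find; lose)
open import Data.List.Membership.Propositional.Properties
  using (∈-++⁺ˡ; ∈-++⁺ʳ; ∈-++⁻; ∈-allFin; ∈-cartesianProduct⁺; ∈-cartesianProduct⁻; ∈-deduplicate⁺; ∈-deduplicate⁻; ∈-filter⁺; ∈-filter⁻; ∈-length; ∈-map⁺; ∈-map⁻; ∈-tabulate⁺; ∈-upTo⁺; ∈-upTo⁻; ∈-∃++)
open import Data.List.Properties
  using (++-assoc; filter-accept; filter-all; filter-reject; length-++; length-drop; length-filter; length-map; length-mapMaybe; length-tabulate; length-upTo; take++drop≡id)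
open import Data.List.Relation.Binary.Permutation.Propositional using (_↭_; prep; swap; ↭-refl; ↭-sym; ↭-trans)
  renaming (refl to ↭-done; trans to ↭-step)
open import Data.List.Relation.Binary.Permutation.Propositional.Properties using (filter-↭; shift; ∈-resp-↭; ↭-length)
open import Data.List.Relation.Binary.Subset.Propositional using (_⊆_)
open import Data.List.Relation.Unary.All as All using (All; []; _∷_)
open import Data.List.Relation.Unary.AllPairs using (AllPairs; []; _∷_)
open import Data.List.Relation.Unary.AllPairs.Properties using (tabulate⁺-<)
open import Data.List.Relation.Unary.Any using (any?; here; there)
open import Data.List.Relation.Unary.Unique.DecPropositional.Properties using (deduplicate-!)
open import Data.List.Relation.Unary.Unique.Propositional using (Unique)
import Data.List.Relation.Unary.Unique.Propositional.Properties as Unique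
open import Data.Maybe as Maybe using (Maybe; just; nothing)
open import Data.Maybe.Properties using (just-injective; ≡-dec)
open import Data.Nat using (ℕ; zero; suc; _+_; _*_; _∸_; _^_; _⊓_; _⊔_; _<_; _≤_; _≤?_; _≥_; s≤s; z≤n)
open import Data.Nat.Combinatorics using (_C_; nC1≡n; nCk+nC[k+1]≡[n+1]C[k+1])
open import Data.Nat.DivMod using (_/_; _%_; /-monoˡ-≤; m%n<n; m/n*n≤m; m<n⇒m/n≡0; m≡m%n+[m/n]*n; n%n≡0; n/n≡1)
open import Data.Nat.Properties hiding (_<?_; _≟_)
import Data.Nat.Properties as ℕ
open import Data.Nat.Tactic.RingSolver using (solve-∀)
open import Data.Product using (Σ-syntax; ∃-syntax; _×_; _,_; proj₁; proj₂; uncurry)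
open import Data.Sum using (_⊎_; inj₁; inj₂)
open import Function using (_∘_; id)
open import Level using (0ℓ)
open import Relation.Binary using (Decidable; Rel)
open import Relation.Binary.PropositionalEquality using (_≡_; _≢_; refl; cong; cong₂; subst; sym; trans; ≢-sym)
open import Relation.Nullary using (Dec; ¬_; contradiction; no; yes)
open import Relation.Nullary.Decidable using (_×-dec_; dec⇒maybe; decidable-stable; ¬?)
import Relation.Unary as U
open import Relation.Unary.Properties using (∁?)

-- Counting in duplicate-free lists.

module _ {A : Set} where

  head-∈ : ∀ {xs : List A} → 0 < length xs → ∃[ x ] x ∈ xs
  head-∈ {x ∷ _} _ = x , here refl

  two-∈ : ∀ {xs : List A} → Unique xs → 2 ≤ length xs →
          ∃[ x ] ∃[ y ] x ∈ xs × y ∈ xs × x ≢ y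
  two-∈ {x ∷ y ∷ _} ((x≢y ∷ _) ∷ _) _ = x , y , here refl , there (here refl) , x≢y
  two-∈ {_ ∷ []} _ (s≤s ())

  Unique-⊆⇒length≤ : ∀ {xs ys : List A} → Unique xs → xs ⊆ ys → length xs ≤ length ys
  Unique-⊆⇒length≤ {[]} _ _ = z≤n
  Unique-⊆⇒length≤ {x ∷ xs} {ys} (x∉xs ∷ xs!) sub with ∈-∃++ (sub (here refl))
  ... | as , bs , refl = begin
    suc (length xs)               ≤⟨ s≤s (Unique-⊆⇒length≤ xs! sub′) ⟩
    suc (length (as ++ bs))       ≡⟨ cong suc (length-++ as) ⟩
    suc (length as + length bs)   ≡⟨ +-suc (length as) (length bs) ⟨
    length as + suc (length bs)   ≡⟨ length-++ as ⟨
    length (as ++ x ∷ bs)         ∎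
    where
    open ≤-Reasoning
    sub′ : xs ⊆ as ++ bs
    sub′ y∈xs with ∈-++⁻ as (sub (there y∈xs))
    ... | inj₁ y∈as         = ∈-++⁺ˡ y∈as
    ... | inj₂ (here refl)  = contradiction refl (All.lookup x∉xs y∈xs)
    ... | inj₂ (there y∈bs) = ∈-++⁺ʳ as y∈bs

  module _ {P : U.Pred A 0ℓ} (P? : U.Decidable P) where

    length-filter-∁ : ∀ xs → length (filter P? xs) + length (filter (∁? P?) xs) ≡ length xs
    length-filter-∁ [] = refl
    length-filter-∁ (x ∷ xs) with P? x
    ... | yes _ = cong suc (length-filter-∁ xs)
    ... | no  _ = trans (+-suc _ _) (cong suc (length-filter-∁ xs))

    length-filter-∁<⇒∃ : ∀ {xs} → length (filter (∁? P?) xs) < length xs → ∃[ x ] x ∈ xs × P x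
    length-filter-∁<⇒∃ {xs} lt = proj₁ h , ∈-filter⁻ P? (proj₂ h)
      where
      h = head-∈ (+-cancelʳ-< (length (filter (∁? P?) xs)) 0 _
            (≤-trans lt (≤-reflexive (sym (length-filter-∁ xs)))))

    filter-mono-length : ∀ {xs ys} → Unique xs → xs ⊆ ys →
                         length (filter P? xs) ≤ length (filter P? ys)
    filter-mono-length xs! sub = Unique-⊆⇒length≤ (Unique.filter⁺ P? xs!) λ x∈ →
      let x∈xs , px = ∈-filter⁻ P? x∈ in ∈-filter⁺ P? (sub x∈xs) px

  ∈-maximal : (f : A → ℕ) {xs : List A} → 0 < length xs →
              ∃[ x ] x ∈ xs × (∀ {y} → y ∈ xs → f y ≤ f x)
  ∈-maximal f {x ∷ xs} _ =
    argmax f x xs ,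
    argmax-all f {P = _∈ x ∷ xs} (here refl) (All.tabulate there) ,
    λ { (here refl) → f[⊥]≤f[argmax] {f = f} x xs
      ; (there y∈) → All.lookup (f[xs]≤f[argmax] x xs) y∈ }

-- Chains in dense digraphs.

module Digraph
  {V : Set} {_⇝_ _~_ : Rel V 0ℓ} (_⇝?_ : Decidable _⇝_) (_~?_ : Decidable _~_)
  (~-irrefl : ∀ {x} → ¬ (x ~ x))
  where

  out non far : V → List V → List V
  out x = filter (x ⇝?_)
  non x = filter (∁? (x ⇝?_))
  far x = filter (∁? (x ~?_))

  -- Each `step` keeps only the out-neighbours of its vertex, so that vertex has arcs to everything
  -- chosen later; `link` is the closing edge.
  data Chain : ℕ → List V → Set where
    link : ∀ {B x y} → x ∈ B → y ∈ B → x ~ y → Chain 0 B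
    step : ∀ {B p x} → x ∈ B → Chain p (out x B) → Chain (suc p) B

  out-⊆ : ∀ x {B} → out x B ⊆ B
  out-⊆ x y∈ = proj₁ (∈-filter⁻ (x ⇝?_) y∈)

  out! : ∀ x {B} → Unique B → Unique (out x B)
  out! x = Unique.filter⁺ (x ⇝?_)

  -- Equivalently, the degree plus the out-degree of v within S is at least 2 |S| - g - 1.
  module _ {S : List V} {g : ℕ}
    (bound : ∀ {v} → v ∈ S → length (non v S) + length (far v S) ≤ suc g)
    where

    -- By irreflexivity x is one of its own non-neighbours; this unit turns `suc g` into `g` in
    -- `non-≤`.
    far-≥1 : ∀ {x} → x ∈ S → 1 ≤ length (far x S)
    far-≥1 {x} x∈S = ∈-length (∈-filter⁺ (∁? (x ~?_)) x∈S ~-irrefl)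

    non-≤ : ∀ {x} → x ∈ S → length (non x S) ≤ g
    non-≤ {x} x∈S = ≤-pred (begin
      suc (length (non x S))                ≡⟨ +-comm 1 _ ⟩
      length (non x S) + 1                  ≤⟨ +-monoʳ-≤ _ (far-≥1 x∈S) ⟩
      length (non x S) + length (far x S)   ≤⟨ bound x∈S ⟩
      suc g                                 ∎)
      where open ≤-Reasoning

    module _ {B : List V} (B! : Unique B) (B⊆S : B ⊆ S) where

      length-out : ∀ x → length B ≤ length (out x B) + length (non x S)
      length-out x = begin
        length B                            ≡⟨ length-filter-∁ (x ⇝?_) B ⟨
        length (out x B) + length (non x B) ≤⟨ +-monoʳ-≤ _ (filter-mono-length (∁? (x ⇝?_)) B! B⊆S) ⟩
        length (out x B) + length (non x S) ∎
        where open ≤-Reasoning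

      length-out-≥ : ∀ {x m} → x ∈ S → m + g ≤ length B → m ≤ length (out x B)
      length-out-≥ {x} {m} x∈S le = +-cancelʳ-≤ g _ _ (begin
        m + g                                 ≤⟨ le ⟩
        length B                              ≤⟨ length-out x ⟩
        length (out x B) + length (non x S)   ≤⟨ +-monoʳ-≤ _ (non-≤ x∈S) ⟩
        length (out x B) + g                  ∎)
        where open ≤-Reasoning

      -- Missing arcs and missing edges share the budget `suc g`: the more non-neighbours x has, the
      -- more out-neighbours it keeps.
      far<out : ∀ {x m} → x ∈ S → m + suc g ≤ length B → m + length (far x S) ≤ length (out x B)
      far<out {x} {m} x∈S le = +-cancelʳ-≤ (length (non x S)) _ _ (begin
        m + φ + ν                      ≡⟨ +-assoc m φ ν ⟩
        m + (φ + ν)                    ≡⟨ cong (m +_) (+-comm φ ν) ⟩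
        m + (ν + φ)                    ≤⟨ +-monoʳ-≤ m (bound x∈S) ⟩
        m + suc g                      ≤⟨ le ⟩
        length B                       ≤⟨ length-out x ⟩
        length (out x B) + ν           ∎)
        where
        open ≤-Reasoning
        φ = length (far x S)
        ν = length (non x S)

      -- A vertex x with the most non-neighbours in B has so many out-neighbours
      -- that one of them is adjacent to another.
      chain-1 : 2 + g ≤ length B → Chain 1 B
      chain-1 le with ∈-maximal (λ x → length (far x B)) (≤-trans (s≤s z≤n) le)
      ... | x , x∈B , max with out-large ← far<out {x} {1} (B⊆S x∈B) le
                          with head-∈ (≤-trans (s≤s z≤n) out-large)
      ... | y , y∈o = step x∈B (link y∈o (proj₁ (proj₂ z-near)) (proj₂ (proj₂ z-near)))
        where
        open ≤-Reasoning
        z-near = length-filter-∁<⇒∃ (y ~?_) {out x B} (begin-strict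
          length (far y (out x B))  ≤⟨ filter-mono-length (∁? (y ~?_)) {ys = B} (out! x B!) (out-⊆ x) ⟩
          length (far y B)          ≤⟨ max (out-⊆ x y∈o) ⟩
          length (far x B)          ≤⟨ filter-mono-length (∁? (x ~?_)) B! B⊆S ⟩
          length (far x S)          <⟨ out-large ⟩
          length (out x B)          ∎)

    -- Passing to out-neighbours costs at most g vertices, so after p steps the 2 + g vertices that
    -- `chain-1` asks for are left.
    chain-loose : ∀ p {B} → Unique B → B ⊆ S → 2 + suc p * g ≤ length B → Chain (suc p) B
    chain-loose zero B! B⊆S le =
      chain-1 B! B⊆S (subst (λ t → 2 + t ≤ _) (+-identityʳ g) le)
    chain-loose (suc p) {B} B! B⊆S le with head-∈ (≤-trans (s≤s z≤n) le)
    ... | x , x∈B = step x∈B (chain-loose p (out! x B!) (B⊆S ∘ out-⊆ x)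
        (length-out-≥ B! B⊆S (B⊆S x∈B)
          (≤-trans (≤-reflexive (cong (2 +_) (+-comm (suc p * g) g))) le)))

    -- A vertex x with a non-neighbour other than itself has g + 2 out-neighbours in
    -- B, and chain-1 applies to them. Otherwise B is complete; then some arc x ⇝ y
    -- in out v B has both ends joined by arcs to all of non v B, which contains an
    -- edge, so v is dropped in favour of x and y.
    chain-2 : ∀ {B} → Unique S → Unique B → B ⊆ S → 2 ≤ g → suc (g + g) ≤ length B → Chain 2 B
    chain-2 {B} S! B! B⊆S 2≤g le with any? (λ x → 2 ≤? length (far x S)) B
    ... | yes a with find a
    ...   | x , x∈B , 2≤far = step x∈B (chain-1 (out! x B!) (B⊆S ∘ out-⊆ x) (begin
      2 + g                  ≡⟨ +-comm 2 g ⟩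
      g + 2                  ≤⟨ +-monoʳ-≤ g 2≤far ⟩
      g + length (far x S)   ≤⟨ far<out B! B⊆S (B⊆S x∈B) (≤-trans (≤-reflexive (+-suc g g)) le) ⟩
      length (out x B)       ∎))
      where open ≤-Reasoning
    chain-2 {B} S! B! B⊆S 2≤g le | no ¬a with head-∈ (≤-trans (s≤s z≤n) le)
    ...   | v , v∈B with 2 + g ≤? length (out v B)
    ...     | yes large = step v∈B (chain-1 (out! v B!) (B⊆S ∘ out-⊆ v) large)
    ...     | no ¬large = finish
      where
      -- A non-neighbour y of x other than x would be a second member of `far x S`.
      complete : ∀ {x y} → x ∈ B → y ∈ B → x ≢ y → x ~ y
      complete {x} {y} x∈B y∈B x≢y = decidable-stable (x ~? y) λ x≁y →
        ¬a (lose x∈B (Unique-⊆⇒length≤ ((x≢y ∷ []) ∷ [] ∷ [])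
          λ { (here refl) → ∈-filter⁺ (∁? (x ~?_)) (B⊆S x∈B) ~-irrefl
            ; (there (here refl)) → ∈-filter⁺ (∁? (x ~?_)) (B⊆S y∈B) x≁y }))

      B′ = out v B
      B′! = out! v B!
      B′⊆B : B′ ⊆ B
      B′⊆B = out-⊆ v
      D = non v B

      g<B′ : suc g ≤ length B′
      g<B′ = length-out-≥ B! B⊆S (B⊆S v∈B) le

      -- At most g + 1 of the at least 2 g + 1 vertices of B are out-neighbours of v, so at least g
      -- remain.
      D≥2 : 2 ≤ length D
      D≥2 = ≤-trans 2≤g (+-cancelˡ-≤ (suc g) _ _ (begin
        suc g + g              ≤⟨ le ⟩
        length B               ≡⟨ length-filter-∁ (v ⇝?_) B ⟨
        length B′ + length D   ≤⟨ +-monoˡ-≤ _ (≤-pred (≰⇒> ¬large)) ⟩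
        suc g + length D       ∎))
        where open ≤-Reasoning

      D∌B′ : ∀ {u} → u ∈ D → u ∉ B′
      D∌B′ u∈D u∈B′ =
        proj₂ (∈-filter⁻ (∁? (v ⇝?_)) {xs = B} u∈D) (proj₂ (∈-filter⁻ (v ⇝?_) {xs = B} u∈B′))

      -- With only one out-neighbour in B′, x has g of its at most g
      -- non-out-neighbours (itself included) in B′, so it has none in D.
      tight : ∀ {x} → x ∈ B′ → Chain 1 B′ ⊎ (∀ {u} → u ∈ D → x ⇝ u)
      tight {x} x∈B′ with 2 ≤? length (out x B′)
      ... | yes two with two-∈ (out! x B′!) two
      ...   | c , d , c∈ , d∈ , c≢d =
        inj₁ (step x∈B′ (link c∈ d∈ (complete (B′⊆B (out-⊆ x c∈)) (B′⊆B (out-⊆ x d∈)) c≢d)))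
      tight {x} x∈B′ | no ¬two = inj₂ λ {u} u∈D → decidable-stable (x ⇝? u) λ ¬x⇝u →
        <⇒≱ {g} (begin-strict
          g                        ≤⟨ +-cancelˡ-≤ 1 _ _ (begin
            suc g                                   ≤⟨ g<B′ ⟩
            length B′                               ≡⟨ length-filter-∁ (x ⇝?_) B′ ⟨
            length (out x B′) + length (non x B′)   ≤⟨ +-monoˡ-≤ _ (≤-pred (≰⇒> ¬two)) ⟩
            suc (length (non x B′))                 ∎) ⟩
          length (non x B′)        <⟨ Unique-⊆⇒length≤
            (All.tabulate (λ w∈ u≡w → D∌B′ u∈D (subst (_∈ B′) (sym u≡w) (proj₁ (∈-filter⁻ (∁? (x ⇝?_)) w∈))))
              ∷ Unique.filter⁺ (∁? (x ⇝?_)) B′!)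
            (λ { (here refl) → ∈-filter⁺ (∁? (x ⇝?_)) (D⊆S u∈D) ¬x⇝u
               ; (there w∈) → let w∈B′ , ¬x⇝w = ∈-filter⁻ (∁? (x ⇝?_)) w∈
                              in ∈-filter⁺ (∁? (x ⇝?_)) (B⊆S (B′⊆B w∈B′)) ¬x⇝w }) ⟩
          length (non x S)         ∎)
        (non-≤ (B⊆S (B′⊆B x∈B′)))
        where
        open ≤-Reasoning
        D⊆S : D ⊆ S
        D⊆S u∈ = B⊆S (proj₁ (∈-filter⁻ (∁? (v ⇝?_)) u∈))

      finish : Chain 2 B
      finish with head-∈ (≤-trans (s≤s z≤n) g<B′)
      -- `B′` has at least g + 1 vertices and passing to `out x B′` loses at most g, so some y is
      -- left.
      ... | x , x∈B′ with head-∈ (length-out-≥ B′! (B⊆S ∘ B′⊆B) (B⊆S (B′⊆B x∈B′)) g<B′)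
      ... | y , y∈o with tight x∈B′ | tight (out-⊆ x y∈o)
      ... | inj₁ ch | _ = step v∈B ch
      ... | inj₂ _ | inj₁ ch = step v∈B ch
      ... | inj₂ x⇝D | inj₂ y⇝D with two-∈ (Unique.filter⁺ (∁? (v ⇝?_)) B!) D≥2
      ... | a , b , a∈D , b∈D , a≢b =
        step (B′⊆B x∈B′) (step (∈-filter⁺ (x ⇝?_) (B′⊆B (out-⊆ x y∈o)) (proj₂ (∈-filter⁻ (x ⇝?_) {xs = B′} y∈o)))
          (link (reach a∈D) (reach b∈D) (complete (D⊆B a∈D) (D⊆B b∈D) a≢b)))
        where
        D⊆B : D ⊆ B
        D⊆B u∈ = proj₁ (∈-filter⁻ (∁? (v ⇝?_)) u∈)
        reach : ∀ {u} → u ∈ D → u ∈ out y (out x B)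
        reach u∈D = ∈-filter⁺ (y ⇝?_) (∈-filter⁺ (x ⇝?_) (D⊆B u∈D) (x⇝D u∈D)) (y⇝D u∈D)

    -- As in `chain-loose` each step costs g, but the recursion stops at `chain-2` on 1 + 2 g
    -- vertices, which saves one vertex.
    chain-tight : ∀ p {B} → Unique S → Unique B → B ⊆ S → 2 ≤ g →
                  1 + (2 + p) * g ≤ length B → Chain (2 + p) B
    chain-tight zero S! B! B⊆S 2≤g le =
      chain-2 S! B! B⊆S 2≤g (subst (λ t → suc (g + t) ≤ _) (+-identityʳ g) le)
    chain-tight (suc p) {B} S! B! B⊆S 2≤g le with head-∈ (≤-trans (s≤s z≤n) le)
    ... | x , x∈B = step x∈B (chain-tight p S! (out! x B!) (B⊆S ∘ out-⊆ x) 2≤g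
        (length-out-≥ B! B⊆S (B⊆S x∈B)
          (≤-trans (≤-reflexive (cong suc (+-comm ((2 + p) * g) g))) le)))

-- Partial functions on lists, and one representative for each new value.

∈-mapMaybe⁺ : ∀ {A B : Set} (f : A → Maybe B) {xs x y} → x ∈ xs → f x ≡ just y → y ∈ mapMaybe f xs
∈-mapMaybe⁺ f {_ ∷ _} (here refl) eq rewrite eq = here refl
∈-mapMaybe⁺ f {x′ ∷ _} (there x∈) eq with f x′
... | just _  = there (∈-mapMaybe⁺ f x∈ eq)
... | nothing = ∈-mapMaybe⁺ f x∈ eq

∈-mapMaybe⁻ : ∀ {A B : Set} (f : A → Maybe B) {xs y} → y ∈ mapMaybe f xs → ∃[ x ] x ∈ xs × f x ≡ just y
∈-mapMaybe⁻ f {x ∷ xs} y∈ with f x in eq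
∈-mapMaybe⁻ f {x ∷ xs} y∈ | nothing with ∈-mapMaybe⁻ f y∈
... | x′ , x′∈ , eq′ = x′ , there x′∈ , eq′
∈-mapMaybe⁻ f {x ∷ xs} (here refl) | just _ = x , here refl , eq
∈-mapMaybe⁻ f {x ∷ xs} (there y∈)  | just _ with ∈-mapMaybe⁻ f y∈
... | x′ , x′∈ , eq′ = x′ , there x′∈ , eq′

-- For `f = M v` and `known` the colours within S, this picks one neighbour of v for each colour
-- that occurs only at v.
record Representatives {V : Set} (f : V → Maybe ℕ) (known : List ℕ) (ws : List V) : Set where
  field
    reps     : List V
    reps-⊆   : reps ⊆ ws
    reps!    : Unique reps
    new      : ∀ {w} → w ∈ reps → ∃[ κ ] f w ≡ just κ × κ ∉ known
    distinct : ∀ {w w′} → w ∈ reps → w′ ∈ reps → f w ≡ f w′ → w ≡ w′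
    cover    : ∀ {w κ} → w ∈ ws → f w ≡ just κ → κ ∈ known ⊎ (∃[ w′ ] w′ ∈ reps × f w′ ≡ just κ)

representatives : ∀ {V : Set} (f : V → Maybe ℕ) known ws → Representatives f known ws
representatives f known [] = record
  { reps = [] ; reps-⊆ = λ () ; reps! = [] ; new = λ () ; distinct = λ () ; cover = λ () }
representatives f known (v ∷ ws) with representatives f known ws
... | R = result
  where
  open Representatives R

  skip : (∀ {κ} → f v ≡ just κ → κ ∈ known ⊎ (∃[ w′ ] w′ ∈ reps × f w′ ≡ just κ)) →
         Representatives f known (v ∷ ws)
  skip cover-v = record
    { reps = reps ; reps-⊆ = there ∘ reps-⊆ ; reps! = reps! ; new = new ; distinct = distinct
    ; cover = λ { (here refl) → cover-v ; (there w∈) → cover w∈ } }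

  result : Representatives f known (v ∷ ws)
  result with f v in eq
  ... | nothing = skip λ fv → contradiction (trans (sym eq) fv) λ ()
  ... | just κ with _∈?_ ℕ._≟_ κ known | any? (λ w → ≡-dec ℕ._≟_ (f w) (just κ)) reps
  ... | yes κ∈ | _ = skip λ fv → inj₁ (subst (_∈ known) (just-injective (trans (sym eq) fv)) κ∈)
  ... | no _ | yes a = skip λ fv → inj₂ (let w , w∈ , fw = find a in w , w∈ , trans fw (trans (sym eq) fv))
  ... | no κ∉ | no ¬a = record
    { reps     = v ∷ reps
    ; reps-⊆   = λ { (here refl) → here refl ; (there w∈) → there (reps-⊆ w∈) }
    ; reps!    = All.tabulate (λ { w∈ refl → ¬a (lose w∈ eq) }) ∷ reps!
    ; new      = λ { (here refl) → κ , eq , κ∉ ; (there w∈) → new w∈ }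
    ; distinct = λ { (here refl) (here refl) _ → refl
                   ; (here refl) (there w∈) fw → contradiction (lose w∈ (trans (sym fw) eq)) ¬a
                   ; (there w∈) (here refl) fw → contradiction (lose w∈ (trans fw eq)) ¬a
                   ; (there w∈) (there w′∈) fw → distinct w∈ w′∈ fw }
    ; cover    = λ { (here refl) fw → inj₂ (v , here refl , fw)
                   ; (there w∈) fw → cover′ (cover w∈ fw) }
    }
    where
    cover′ : ∀ {κ} → κ ∈ known ⊎ (∃[ w′ ] w′ ∈ reps × f w′ ≡ just κ) →
             κ ∈ known ⊎ (∃[ w′ ] w′ ∈ v ∷ reps × f w′ ≡ just κ)
    cover′ (inj₁ κ∈) = inj₁ κ∈
    cover′ (inj₂ (w , w∈ , fw)) = inj₂ (w , there w∈ , fw)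

-- Weight of a vertex set: edges plus colours.

exchange : ∀ {a a′ b b′ c c′} → a ≡ a′ → b ≡ b′ → c ≡ c′ → a + (b + c) ≡ b′ + (a′ + c′)
exchange {a} {b = b} {c = c} refl refl refl = lemma a b c
  where
  lemma : ∀ a b c → a + (b + c) ≡ b + (a + c)
  lemma = solve-∀

-- 2 · (n choose 2), the largest possible value of e + c on n vertices.
pairs : ℕ → ℕ
pairs zero    = 0
pairs (suc n) = pairs n + (n + n)

-- A vertex whose degree plus number of saturated colours is at most 2 n − g n can
-- be removed from n + 1 vertices without the weight dropping below the threshold.
threshold : ℕ → (ℕ → ℕ) → ℕ → ℕ
threshold t₀ g zero    = t₀
threshold t₀ g (suc n) = threshold t₀ g n + (n + (n ∸ g n))

-- M u v is the colour of the edge uv, and nothing when u and v are not adjacent.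
module ColourMatrix {n : ℕ} (M : Fin n → Fin n → Maybe ℕ)
  (M-sym : ∀ u v → M u v ≡ M v u) (M-irrefl : ∀ u → M u u ≡ nothing)
  where

  V : Set
  V = Fin n

  _~_ : Rel V 0ℓ
  u ~ v = ∃[ κ ] M u v ≡ just κ

  _~?_ : Decidable _~_
  u ~? v with M u v
  ... | just κ  = yes (κ , refl)
  ... | nothing = no λ ()

  ~-sym : ∀ {u v} → u ~ v → v ~ u
  ~-sym {u} {v} (κ , eq) = κ , trans (M-sym v u) eq

  ~-irrefl : ∀ {u} → ¬ (u ~ u)
  ~-irrefl {u} (κ , eq) = contradiction (trans (sym (M-irrefl u)) eq) λ ()

  -- In a duplicate-free list each edge is counted at the end that comes first, so putting a vertex
  -- in front adds its degree.
  edgeCount : List V → ℕ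
  edgeCount []       = 0
  edgeCount (x ∷ xs) = length (filter (x ~?_) xs) + edgeCount xs

  colours : List V → List ℕ
  colours S = mapMaybe (uncurry M) (cartesianProduct S S)

  colourCount : List V → ℕ
  colourCount S = length (deduplicate ℕ._≟_ (colours S))

  weight : List V → ℕ
  weight S = edgeCount S + colourCount S

  ∈-colours⁺ : ∀ {S u v κ} → u ∈ S → v ∈ S → M u v ≡ just κ → κ ∈ colours S
  ∈-colours⁺ u∈ v∈ = ∈-mapMaybe⁺ (uncurry M) (∈-cartesianProduct⁺ u∈ v∈)

  ∈-colours⁻ : ∀ {S κ} → κ ∈ colours S → ∃[ u ] ∃[ v ] u ∈ S × v ∈ S × M u v ≡ just κ
  ∈-colours⁻ {S} κ∈ with ∈-mapMaybe⁻ (uncurry M) κ∈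
  ... | (u , v) , uv∈ , eq with ∈-cartesianProduct⁻ S S uv∈
  ... | u∈ , v∈ = u , v , u∈ , v∈ , eq

  colours-⊆ : ∀ {S T} → S ⊆ T → colours S ⊆ colours T
  colours-⊆ S⊆T κ∈ = let u , v , u∈ , v∈ , eq = ∈-colours⁻ κ∈ in ∈-colours⁺ (S⊆T u∈) (S⊆T v∈) eq

  distinct-⊆⇒length≤ : ∀ {κs κs′} → κs ⊆ κs′ →
                       length (deduplicate ℕ._≟_ κs) ≤ length (deduplicate ℕ._≟_ κs′)
  distinct-⊆⇒length≤ {κs} sub = Unique-⊆⇒length≤ (deduplicate-! ℕ._≟_ κs)
    (∈-deduplicate⁺ ℕ._≟_ ∘ sub ∘ ∈-deduplicate⁻ ℕ._≟_ κs)

  -- Only `swap` needs an argument: by symmetry of `_~_` the pair x, y contributes equally in both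
  -- orders, and `exchange` reorders the remaining terms.
  edgeCount-↭ : ∀ {S T} → S ↭ T → edgeCount S ≡ edgeCount T
  edgeCount-↭ ↭-done = refl
  edgeCount-↭ (prep x p) = cong₂ _+_ (↭-length (filter-↭ (x ~?_) p)) (edgeCount-↭ p)
  edgeCount-↭ (↭-step p q) = trans (edgeCount-↭ p) (edgeCount-↭ q)
  edgeCount-↭ (swap {S} {T} x y p) with x ~? y | y ~? x
  ... | yes _  | yes _  = cong suc (exchange
    (↭-length (filter-↭ (x ~?_) p)) (↭-length (filter-↭ (y ~?_) p)) (edgeCount-↭ p))
  ... | no _   | no _   = exchange
    (↭-length (filter-↭ (x ~?_) p)) (↭-length (filter-↭ (y ~?_) p)) (edgeCount-↭ p)
  ... | yes xy | no ¬yx = contradiction (~-sym xy) ¬yx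
  ... | no ¬xy | yes yx = contradiction (~-sym yx) ¬xy

  module _ (v : V) (S : List V) where

    open Representatives (representatives (M v) (colours S) S) public

    -- A colour seen on `v ∷ S` either occurs within S already or is the colour of an edge from v to
    -- a representative.
    weight-∷ : weight (v ∷ S) ≤ weight S + (length (filter (v ~?_) S) + length reps)
    weight-∷ = begin
      d + edgeCount S + colourCount (v ∷ S)            ≤⟨ +-monoʳ-≤ (d + edgeCount S) colourCount-∷ ⟩
      d + edgeCount S + (colourCount S + length reps)  ≡⟨ regroup d (edgeCount S) (colourCount S) (length reps) ⟩
      weight S + (d + length reps)                     ∎
      where
      open ≤-Reasoning
      d = length (filter (v ~?_) S)

      regroup : ∀ a b c d → a + b + (c + d) ≡ b + c + (a + d)
      regroup = solve-∀

      old = deduplicate ℕ._≟_ (colours S)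
      fresh = mapMaybe (M v) reps

      at-v : ∀ {w κ} → w ∈ S → M v w ≡ just κ → κ ∈ old ++ fresh
      at-v w∈ eq with cover w∈ eq
      ... | inj₁ κ∈ = ∈-++⁺ˡ (∈-deduplicate⁺ ℕ._≟_ κ∈)
      ... | inj₂ (w′ , w′∈ , eq′) = ∈-++⁺ʳ old (∈-mapMaybe⁺ (M v) w′∈ eq′)

      covered : colours (v ∷ S) ⊆ old ++ fresh
      covered κ∈ with ∈-colours⁻ κ∈
      ... | _ , _ , here refl , here refl , eq = contradiction (trans (sym (M-irrefl v)) eq) λ ()
      ... | _ , _ , here refl , there w∈  , eq = at-v w∈ eq
      ... | u , _ , there u∈  , here refl , eq = at-v u∈ (trans (M-sym v u) eq)
      ... | _ , _ , there u∈  , there w∈  , eq = ∈-++⁺ˡ (∈-deduplicate⁺ ℕ._≟_ (∈-colours⁺ u∈ w∈ eq))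

      colourCount-∷ : colourCount (v ∷ S) ≤ colourCount S + length reps
      colourCount-∷ = begin
        colourCount (v ∷ S)            ≤⟨ Unique-⊆⇒length≤ (deduplicate-! ℕ._≟_ (colours (v ∷ S)))
                                            (covered ∘ ∈-deduplicate⁻ ℕ._≟_ _) ⟩
        length (old ++ fresh)          ≡⟨ length-++ old ⟩
        colourCount S + length fresh   ≤⟨ +-monoʳ-≤ (colourCount S) (length-mapMaybe (M v) reps) ⟩
        colourCount S + length reps    ∎

    weight-∷-≤ : Unique S → weight (v ∷ S) ≤ weight S + (length S + length S)
    weight-∷-≤ S! = ≤-trans weight-∷ (+-monoʳ-≤ (weight S)
      (+-mono-≤ (length-filter (v ~?_) S) (Unique-⊆⇒length≤ reps! reps-⊆)))

  -- Removing the vertices of R one by one loses at most 2 l whenever l vertices remain, and these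
  -- losses sum to the difference of the two values of `pairs`.
  weight-++ : ∀ R {S} → Unique (R ++ S) →
              weight (R ++ S) + pairs (length S) ≤ weight S + pairs (length (R ++ S))
  weight-++ []      _           = ≤-refl
  weight-++ (v ∷ R) {S} (_ ∷ RS!) = begin
    weight (v ∷ R ++ S) + pairs s          ≤⟨ +-monoˡ-≤ (pairs s) (weight-∷-≤ v (R ++ S) RS!) ⟩
    weight (R ++ S) + (l + l) + pairs s    ≡⟨ regroup (weight (R ++ S)) (l + l) (pairs s) ⟩
    weight (R ++ S) + pairs s + (l + l)    ≤⟨ +-monoˡ-≤ (l + l) (weight-++ R RS!) ⟩
    weight S + pairs l + (l + l)           ≡⟨ +-assoc (weight S) (pairs l) (l + l) ⟩
    weight S + pairs (suc l)               ∎
    where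
    open ≤-Reasoning
    l = length (R ++ S)
    s = length S
    regroup : ∀ a b c → a + b + c ≡ a + c + b
    regroup = solve-∀

  weight-≤-pairs : ∀ {S} → Unique S → weight S ≤ pairs (length S)
  weight-≤-pairs []                       = z≤n
  weight-≤-pairs {v ∷ S} (_ ∷ S!) =
    ≤-trans (weight-∷-≤ v S S!) (+-monoˡ-≤ (length S + length S) (weight-≤-pairs S!))

  weight-↭ : ∀ {S T} → S ↭ T → weight S ≤ weight T
  weight-↭ p = +-mono-≤ (≤-reflexive (edgeCount-↭ p)) (distinct-⊆⇒length≤ (colours-⊆ (∈-resp-↭ p)))

  _−_ : List V → V → List V
  S − x = filter (λ y → ¬? (y ≟ x)) S

  −! : ∀ {S} x → Unique S → Unique (S − x)
  −! x = Unique.filter⁺ (λ y → ¬? (y ≟ x))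

  −-⊆ : ∀ {S} x → S − x ⊆ S
  −-⊆ x y∈ = proj₁ (∈-filter⁻ (λ y → ¬? (y ≟ x)) y∈)

  −-↭ : ∀ {S x} → Unique S → x ∈ S → S ↭ x ∷ (S − x)
  −-↭ {y ∷ S} (y∉S ∷ S!) (here refl)
    rewrite filter-reject (λ z → ¬? (z ≟ y)) {y} {S} (λ y≢y → y≢y refl)
          | filter-all (λ z → ¬? (z ≟ y)) (All.map ≢-sym y∉S) = ↭-refl
  −-↭ {y ∷ S} {x} (y∉S ∷ S!) (there x∈)
    rewrite filter-accept (λ z → ¬? (z ≟ x)) {y} {S} (All.lookup y∉S x∈) =
    ↭-step (prep y (−-↭ S! x∈)) (swap y x ↭-refl)

  -- Rainbow cliques in a colour matrix.

  record Clique (h : ℕ) (B : List V) : Set where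
    field
      at       : Fin h → V
      at-∈     : ∀ i → at i ∈ B
      adjacent : ∀ {i j} → i ≢ j → at i ~ at j
      colours-distinct : ∀ {i j i′ j′} → i ≢ j → i′ ≢ j′ → M (at i) (at j) ≡ M (at i′) (at j′) →
                 (i ≡ i′ × j ≡ j′) ⊎ (i ≡ j′ × j ≡ i′)

    at-injective : ∀ {i j} → at i ≡ at j → i ≡ j
    at-injective {i} {j} eq = decidable-stable (i ≟ j) λ i≢j →
      ~-irrefl (subst (_~ at j) eq (adjacent i≢j))

  Clique-⊆ : ∀ {h B B′} → B ⊆ B′ → Clique h B → Clique h B′
  Clique-⊆ sub Q = record { at = at ; at-∈ = sub ∘ at-∈ ; adjacent = adjacent ; colours-distinct = colours-distinct }
    where open Clique Q

  pair-clique : ∀ {B x y} → x ∈ B → y ∈ B → x ~ y → Clique 2 B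
  pair-clique {B} {x} {y} x∈ y∈ xy = record
    { at       = λ { zero → x ; (suc zero) → y }
    ; at-∈     = λ { zero → x∈ ; (suc zero) → y∈ }
    ; adjacent = λ { {zero} {zero} 0≢0 → contradiction refl 0≢0
                   ; {zero} {suc zero} _ → xy
                   ; {suc zero} {zero} _ → ~-sym xy
                   ; {suc zero} {suc zero} 1≢1 → contradiction refl 1≢1 }
    ; colours-distinct = λ {i} {j} {i′} {j′} i≢j i′≢j′ _ → two i j i′ j′ i≢j i′≢j′
    }
    where
    two : ∀ (i j i′ j′ : Fin 2) → i ≢ j → i′ ≢ j′ → (i ≡ i′ × j ≡ j′) ⊎ (i ≡ j′ × j ≡ i′)
    two zero       zero       _          _          i≢j _ = contradiction refl i≢j
    two (suc zero) (suc zero) _          _          i≢j _ = contradiction refl i≢j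
    two _          _          zero       zero       _ i≢j = contradiction refl i≢j
    two _          _          (suc zero) (suc zero) _ i≢j = contradiction refl i≢j
    two zero       (suc zero) zero       (suc zero) _ _ = inj₁ (refl , refl)
    two zero       (suc zero) (suc zero) zero       _ _ = inj₂ (refl , refl)
    two (suc zero) zero       zero       (suc zero) _ _ = inj₂ (refl , refl)
    two (suc zero) zero       (suc zero) zero       _ _ = inj₁ (refl , refl)

  -- The digraph of colours occurring at one vertex only.

  module Saturation {S : List V} (S! : Unique S) where

    _⇝_ : Rel V 0ℓ
    x ⇝ y = y ∈ reps x (S − x)

    _⇝?_ : Decidable _⇝_
    x ⇝? y = _∈?_ _≟_ y (reps x (S − x))

    open Digraph _⇝?_ _~?_ ~-irrefl public

    ⇝⇒∈ : ∀ {x y} → x ⇝ y → y ∈ S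
    ⇝⇒∈ {x} xy = −-⊆ x (reps-⊆ x (S − x) xy)

    -- Arcs from x have pairwise different colours because their heads are representatives (`same`),
    -- and these colours occur nowhere within `S − x`, where the old clique lies (`apart`).
    extend : ∀ {h B x} → x ∈ B → B ⊆ S → Clique h (out x B) → Clique (suc h) B
    extend {h} {B} {x} x∈B B⊆S Q = record
      { at = at′ ; at-∈ = at′-∈ ; adjacent = adjacent′ _ _ ; colours-distinct = colours-distinct′ _ _ _ _ }
      where
      open Clique Q

      arc : ∀ i → x ⇝ at i
      arc i = proj₂ (∈-filter⁻ (x ⇝?_) {xs = B} (at-∈ i))

      at-∈− : ∀ i → at i ∈ S − x
      at-∈− i = reps-⊆ x (S − x) (arc i)

      apart : ∀ {i j i′} → i ≢ j → M x (at i′) ≢ M (at i) (at j)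
      apart {i} {j} {i′} i≢j eq with new x (S − x) (arc i′)
      ... | κ , eq′ , κ∉ = κ∉ (∈-colours⁺ (at-∈− i) (at-∈− j) (trans (sym eq) eq′))

      same : ∀ {i j} → M x (at i) ≡ M x (at j) → i ≡ j
      same {i} {j} eq = at-injective (distinct x (S − x) (arc i) (arc j) eq)

      at′ : Fin (suc h) → V
      at′ zero    = x
      at′ (suc i) = at i

      at′-∈ : ∀ i → at′ i ∈ B
      at′-∈ zero    = x∈B
      at′-∈ (suc i) = out-⊆ x (at-∈ i)

      x~at : ∀ i → x ~ at i
      x~at i = let κ , eq , _ = new x (S − x) (arc i) in κ , eq

      adjacent′ : ∀ i j → i ≢ j → at′ i ~ at′ j
      adjacent′ zero    zero    i≢j = contradiction refl i≢j
      adjacent′ zero    (suc j) _   = x~at j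
      adjacent′ (suc i) zero    _   = ~-sym (x~at i)
      adjacent′ (suc i) (suc j) i≢j = adjacent (i≢j ∘ cong suc)

      colours-distinct′ : ∀ i j i′ j′ → i ≢ j → i′ ≢ j′ → M (at′ i) (at′ j) ≡ M (at′ i′) (at′ j′) →
                 (i ≡ i′ × j ≡ j′) ⊎ (i ≡ j′ × j ≡ i′)
      colours-distinct′ zero zero _ _ i≢j _ _ = contradiction refl i≢j
      colours-distinct′ _ _ zero zero _ i≢j _ = contradiction refl i≢j
      colours-distinct′ zero (suc j) zero (suc j′) _ _ eq = inj₁ (refl , cong suc (same eq))
      colours-distinct′ zero (suc j) (suc i′) zero _ _ eq =
        inj₂ (refl , cong suc (same (trans eq (M-sym (at i′) x))))
      colours-distinct′ (suc i) zero zero (suc j′) _ _ eq =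
        inj₂ (cong suc (same (trans (M-sym x (at i)) eq)) , refl)
      colours-distinct′ (suc i) zero (suc i′) zero _ _ eq =
        inj₁ (cong suc (same (trans (M-sym x (at i)) (trans eq (M-sym (at i′) x)))) , refl)
      colours-distinct′ zero (suc _) (suc _) (suc _) _ i≢j eq = contradiction eq (apart (i≢j ∘ cong suc))
      colours-distinct′ (suc i) zero (suc _) (suc _) _ i≢j eq =
        contradiction (trans (M-sym x (at i)) eq) (apart (i≢j ∘ cong suc))
      colours-distinct′ (suc _) (suc _) zero (suc _) i≢j _ eq = contradiction (sym eq) (apart (i≢j ∘ cong suc))
      colours-distinct′ (suc _) (suc _) (suc i′) zero i≢j _ eq =
        contradiction (trans (M-sym x (at i′)) (sym eq)) (apart (i≢j ∘ cong suc))
      colours-distinct′ (suc i) (suc j) (suc i′) (suc j′) i≢j i′≢j′ eq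
        with colours-distinct (i≢j ∘ cong suc) (i′≢j′ ∘ cong suc) eq
      ... | inj₁ (refl , refl) = inj₁ (refl , refl)
      ... | inj₂ (refl , refl) = inj₂ (refl , refl)

    chain⇒clique : ∀ {p B} → B ⊆ S → Chain p B → Clique (2 + p) B
    chain⇒clique B⊆S (link x∈ y∈ xy) = pair-clique x∈ y∈ xy
    chain⇒clique B⊆S (step {x = x} x∈ ch) = extend x∈ B⊆S (chain⇒clique (B⊆S ∘ out-⊆ x) ch)

    module _ {x : V} (x∈S : x ∈ S) where

      degree+saturated : ℕ
      degree+saturated = length (filter (x ~?_) (S − x)) + length (reps x (S − x))

      weight-− : weight S ≤ weight (S − x) + degree+saturated
      weight-− = ≤-trans (weight-↭ (−-↭ S! x∈S)) (weight-∷ x (S − x))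

      -- Within S, `non` is complementary to the out-neighbours and `far` to the neighbours, and
      -- every representative is an out-neighbour.
      non+far : length (non x S) + length (far x S) + degree+saturated ≤ length S + length S
      non+far = begin
        ν + φ + (d + length (reps x (S − x)))
          ≤⟨ +-monoʳ-≤ (ν + φ) (+-mono-≤ (filter-mono-length (x ~?_) {ys = S} (−! x S!) (−-⊆ x))
               (Unique-⊆⇒length≤ (reps! x (S − x)) λ y∈ → ∈-filter⁺ (x ⇝?_) (⇝⇒∈ y∈) y∈)) ⟩
        ν + φ + (length (filter (x ~?_) S) + length (out x S))
          ≡⟨ regroup ν φ (length (filter (x ~?_) S)) (length (out x S)) ⟩
        length (out x S) + ν + (length (filter (x ~?_) S) + φ)
          ≡⟨ cong₂ _+_ (length-filter-∁ (x ⇝?_) S) (length-filter-∁ (x ~?_) S) ⟩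
        length S + length S ∎
        where
        open ≤-Reasoning
        ν = length (non x S)
        φ = length (far x S)
        d = length (filter (x ~?_) (S − x))
        regroup : ∀ a b c d → a + b + (c + d) ≡ d + a + (c + b)
        regroup = solve-∀

    -- The closing edge of a chain gives two vertices, so `3 + p` vertices take `1 + p` steps. The
    -- tight alternative has p ≥ 1 because `chain-tight` makes at least two steps.
    clique-from-bound : ∀ {g} p → (∀ {x} → x ∈ S → length (non x S) + length (far x S) ≤ suc g) →
      2 + suc p * g ≤ length S ⊎ (∃[ p′ ] p ≡ suc p′ × 2 ≤ g × 1 + suc p * g ≤ length S) →
      Clique (3 + p) S
    clique-from-bound p bound (inj₁ le) = chain⇒clique id (chain-loose bound p S! id le)
    clique-from-bound _ bound (inj₂ (p , refl , 2≤g , le)) =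
      chain⇒clique id (chain-tight bound p S! S! id 2≤g le)

  -- Induction on the number of vertices.

  module _ {p t₀ : ℕ} {g : ℕ → ℕ} (0<t₀ : 0 < t₀)
    (cases : ∀ n → pairs (suc n) < threshold t₀ g (suc n) ⊎
                   (suc p * g n < n ⊎ (∃[ p′ ] p ≡ suc p′ × 2 ≤ g n × suc p * g n ≤ n)))
    where

    -- By `cases`, either the threshold exceeds any weight that n + 1 vertices can have, or n + 1
    -- vertices suffice for a chain once no vertex can be deleted.
    weight⇒clique : ∀ {S} n → length S ≡ n → Unique S → threshold t₀ g n ≤ weight S → Clique (3 + p) S
    weight⇒clique {[]} zero _ _ le = contradiction le (<⇒≱ 0<t₀)
    weight⇒clique {S} (suc n) len S! le with cases n
    ... | inj₁ vacuous =
      contradiction (≤-trans le (weight-≤-pairs S!)) (<⇒≱ (subst (λ l → pairs l < _) (sym len) vacuous))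
    ... | inj₂ large with any? (λ x → threshold t₀ g n ≤? weight (S − x)) S
    ... | yes a with find a
    ... | x , x∈S , le′ = Clique-⊆ (−-⊆ x) (weight⇒clique n (suc-injective
            (trans (sym (↭-length (−-↭ S! x∈S))) len)) (−! x S!) le′)
    weight⇒clique {S} (suc n) len S! le | inj₂ large | no ¬a =
      clique-from-bound p bound (large′ large)
      where
      open Saturation S!
      open ≤-Reasoning

      large′ : suc p * g n < n ⊎ (∃[ p′ ] p ≡ suc p′ × 2 ≤ g n × suc p * g n ≤ n) →
               2 + suc p * g n ≤ length S ⊎ (∃[ p′ ] p ≡ suc p′ × 2 ≤ g n × 1 + suc p * g n ≤ length S)
      large′ rewrite len = λ { (inj₁ lt) → inj₁ (s≤s lt)
                             ; (inj₂ (p′ , eq , 2≤g , le)) → inj₂ (p′ , eq , 2≤g , s≤s le) }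

      bound : ∀ {x} → x ∈ S → length (non x S) + length (far x S) ≤ suc (g n)
      bound {x} x∈S = +-cancelʳ-≤ ds _ _ (begin
        length (non x S) + length (far x S) + ds   ≤⟨ non+far x∈S ⟩
        length S + length S                        ≡⟨ cong₂ _+_ len len ⟩
        -- Truncation does no harm: n ≤ g n + (n ∸ g n) also holds when g n exceeds n.
        suc n + suc n                              ≤⟨ +-monoʳ-≤ (suc n) (s≤s (m≤n+m∸n n (g n))) ⟩
        suc n + suc (g n + (n ∸ g n))              ≡⟨ regroup n (g n) (n ∸ g n) ⟩
        suc (g n) + suc (n + (n ∸ g n))            ≤⟨ +-monoʳ-≤ (suc (g n)) many ⟩
        suc (g n) + ds                             ∎)
        where
        ds = degree+saturated x∈S
        regroup : ∀ a b c → suc a + suc (b + c) ≡ suc b + suc (a + c)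
        regroup = solve-∀
        -- Deleting x takes the weight below the smaller threshold, so x accounts for more than the
        -- increment between the two thresholds.
        many : n + (n ∸ g n) < ds
        many = +-cancelˡ-< (threshold t₀ g n) _ _ (begin-strict
          threshold t₀ g n + (n + (n ∸ g n))   ≤⟨ le ⟩
          weight S                               ≤⟨ weight-− x∈S ⟩
          weight (S − x) + ds                    <⟨ +-monoˡ-< ds (≰⇒> λ le′ → ¬a (lose x∈S le′)) ⟩
          threshold t₀ g n + ds                ∎)

-- From coloured graphs to colour matrices.

length-mapMaybe-filter : ∀ {A B : Set} (f : A → Maybe B) {P : U.Pred A 0ℓ} (P? : U.Decidable P) →
  (∀ x {y} → f x ≡ just y → P x) → ∀ xs → length (mapMaybe f xs) ≤ length (filter P? xs)
length-mapMaybe-filter f P? sound [] = z≤n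
length-mapMaybe-filter f P? sound (x ∷ xs) with f x in eq | P? x
... | just _  | yes _ = s≤s (length-mapMaybe-filter f P? sound xs)
... | just _  | no ¬p = contradiction (sound x eq) ¬p
... | nothing | yes _ = m≤n⇒m≤1+n (length-mapMaybe-filter f P? sound xs)
... | nothing | no  _ = length-mapMaybe-filter f P? sound xs

map-dec⇒maybe⁻ : ∀ {A B : Set} {h : A → B} (d : Dec A) {y} → Maybe.map h (dec⇒maybe d) ≡ just y → A
map-dec⇒maybe⁻ (yes a) _ = a

map-dec⇒maybe⁺ : ∀ {A B : Set} {h : A → B} (d : Dec A) → A → ∃[ a ] Maybe.map h (dec⇒maybe d) ≡ just (h a)
map-dec⇒maybe⁺ (yes a) _ = a , refl
map-dec⇒maybe⁺ (no ¬a) a = contradiction a ¬a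

∈-edges : ∀ {n} (G : Graph n) {u v} → u Fin.< v → Adj G u v → ∃[ a ] ((u , v) , a) ∈ edges G
∈-edges G {u} {v} u<v uv with map-dec⇒maybe⁺ {h = (u , v) ,_} (u <? v ×-dec adj? G u v) (u<v , uv)
... | a , eq = a , ∈-mapMaybe⁺ _ (∈-cartesianProduct⁺ (∈-allFin u) (∈-allFin v)) eq

allFin-sorted : ∀ n → AllPairs Fin._<_ (allFin n)
allFin-sorted n = tabulate⁺-< id

module _ {n} {G : Graph n} (χ : Colouring G) where

  matrix : Fin n → Fin n → Maybe ℕ
  matrix u v with adj? G u v
  ... | yes a = just (colour χ u v a)
  ... | no  _ = nothing

  -- It does not matter which proof `adj?` returns, since `colour` takes adjacency irrelevantly.
  matrix⁺ : ∀ {u v} (a : Adj G u v) → matrix u v ≡ just (colour χ u v a)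
  matrix⁺ {u} {v} a with adj? G u v
  ... | yes _ = refl
  ... | no ¬a = contradiction a ¬a

  matrix⁻ : ∀ {u v κ} → matrix u v ≡ just κ → Adj G u v
  matrix⁻ {u} {v} eq with adj? G u v
  ... | yes a = a
  matrix⁻ () | no _

  matrix-sym : ∀ u v → matrix u v ≡ matrix v u
  matrix-sym u v with adj? G u v
  ... | yes a = trans (cong just (colour-sym χ u v a)) (sym (matrix⁺ (Adj-sym G a)))
  ... | no ¬a with adj? G v u
  ... | yes a = contradiction (Adj-sym G a) ¬a
  ... | no  _ = refl

  matrix-irrefl : ∀ u → matrix u u ≡ nothing
  matrix-irrefl u with adj? G u u
  ... | yes a = contradiction a (irrefl G refl)
  ... | no  _ = refl

  open ColourMatrix matrix matrix-sym matrix-irrefl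

  adjacentPairs : List (Fin n) → List (Fin n × Fin n)
  adjacentPairs []       = []
  adjacentPairs (x ∷ xs) = map (x ,_) (filter (x ~?_) xs) ++ adjacentPairs xs

  length-adjacentPairs : ∀ S → length (adjacentPairs S) ≡ edgeCount S
  length-adjacentPairs []       = refl
  length-adjacentPairs (x ∷ xs) = trans (length-++ (map (x ,_) (filter (x ~?_) xs)))
    (cong₂ _+_ (length-map (x ,_) (filter (x ~?_) xs)) (length-adjacentPairs xs))

  -- In an increasing list the smaller end of an edge comes first, and `adjacentPairs` records the
  -- edge there.
  ∈-adjacentPairs : ∀ {S u v} → AllPairs Fin._<_ S → u ∈ S → v ∈ S → u Fin.< v → u ~ v →
                    (u , v) ∈ adjacentPairs S
  ∈-adjacentPairs _ (here refl) (here refl) u<u _ = contradiction u<u (<F-irrefl refl)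
  ∈-adjacentPairs (x<S ∷ _) (there u∈) (here refl) u<v _ = contradiction u<v (<F-asym (All.lookup x<S u∈))
  ∈-adjacentPairs {x ∷ _} _ (here refl) (there v∈) _ uv = ∈-++⁺ˡ (∈-map⁺ (x ,_) (∈-filter⁺ (x ~?_) v∈ uv))
  ∈-adjacentPairs {x ∷ S} (_ ∷ sorted) (there u∈) (there v∈) u<v uv =
    ∈-++⁺ʳ (map (x ,_) (filter (x ~?_) S)) (∈-adjacentPairs sorted u∈ v∈ u<v uv)

  e≤edgeCount : e G ≤ edgeCount (allFin n)
  e≤edgeCount = begin
    length (edges G)                     ≤⟨ length-mapMaybe-filter _ ordered? sound allPairs ⟩
    length (filter ordered? allPairs)    ≤⟨ Unique-⊆⇒length≤
      (Unique.filter⁺ ordered? (Unique.cartesianProduct⁺ (Unique.allFin⁺ n) (Unique.allFin⁺ n)))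
      (λ {uv} uv∈ → let u<v , u~v = proj₂ (∈-filter⁻ ordered? {xs = allPairs} uv∈) in
        ∈-adjacentPairs (allFin-sorted n) (∈-allFin (proj₁ uv)) (∈-allFin (proj₂ uv)) u<v u~v) ⟩
    length (adjacentPairs (allFin n))    ≡⟨ length-adjacentPairs (allFin n) ⟩
    edgeCount (allFin n)                 ∎
    where
    open ≤-Reasoning
    allPairs = cartesianProduct (allFin n) (allFin n)
    ordered? = λ ((u , v) : Fin n × Fin n) → u <? v ×-dec u ~? v
    sound : ∀ uv {y : Edge G} →
            Maybe.map (uv ,_) (dec⇒maybe (proj₁ uv <? proj₂ uv ×-dec adj? G (proj₁ uv) (proj₂ uv))) ≡ just y →
            proj₁ uv Fin.< proj₂ uv × proj₁ uv ~ proj₂ uv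
    sound (u , v) eq = let u<v , a = map-dec⇒maybe⁻ (u <? v ×-dec adj? G u v) eq in
      u<v , colour χ u v a , matrix⁺ a

  c≤colourCount : c χ ≤ colourCount (allFin n)
  c≤colourCount = distinct-⊆⇒length≤ {map (edgeColour χ) (edges G)} λ κ∈ →
    let ((u , v) , _ , a) , _ , eq = ∈-map⁻ (edgeColour χ) κ∈
    in ∈-colours⁺ (∈-allFin u) (∈-allFin v) (trans (matrix⁺ a) (cong just (sym eq)))

  clique⇒copy : ∀ {h B} → Clique h B → RainbowCopy χ (K h)
  clique⇒copy Q = record
    { vertex    = at
    ; injective = at-injective
    ; edge      = edge′
    ; rainbow   = λ i≢j i′≢j′ eq → colours-distinct i≢j i′≢j′
        (trans (matrix⁺ (edge′ i≢j)) (trans (cong just eq) (sym (matrix⁺ (edge′ i′≢j′)))))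
    }
    where
    open Clique Q
    edge′ : ∀ {i j} → i ≢ j → Adj G (at i) (at j)
    edge′ i≢j = matrix⁻ (proj₂ (adjacent i≢j))

-- Explicit colourings as lower bounds for rb.

module _ (N : ℕ) (f : ℕ → ℕ → ℕ) (f-sym : ∀ i j → f i j ≡ f j i) where

  colourBy : Colouring (K N)
  colourBy = record
    { colour     = λ u v _ → f (toℕ u) (toℕ v)
    ; colour-sym = λ u v _ → f-sym (toℕ u) (toℕ v)
    }

  colourBy-c : ∀ {κs} → Unique κs → (∀ {κ} → κ ∈ κs → ∃[ i ] ∃[ j ] i < j × j < N × f i j ≡ κ) →
               length κs ≤ c colourBy
  colourBy-c κs! used = Unique-⊆⇒length≤ κs! (∈-deduplicate⁺ ℕ._≟_ ∘ present)
    where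
    present : ∀ {κ} → κ ∈ _ → κ ∈ map (edgeColour colourBy) (edges (K N))
    present κ∈ with used κ∈
    ... | i , j , i<j , j<N , refl
      with ∈-edges (K N) {fromℕ< (<-trans i<j j<N)} {fromℕ< j<N} u<v (<F⇒≢ u<v)
      where
      u<v : fromℕ< (<-trans i<j j<N) Fin.< fromℕ< j<N
      u<v rewrite toℕ-fromℕ< (<-trans i<j j<N) | toℕ-fromℕ< j<N = i<j
    ... | a , uv∈ = subst (_∈ map (edgeColour colourBy) (edges (K N)))
          (cong₂ f (toℕ-fromℕ< (<-trans i<j j<N)) (toℕ-fromℕ< j<N)) (∈-map⁺ (edgeColour colourBy) uv∈)

rainbow-free⇒< : ∀ {N h r} {H : Graph h} (χ : Colouring (K N)) →
                 ForcesRainbow (K N) H r → ¬ RainbowCopy χ H → c χ < r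
rainbow-free⇒< χ forces free = ≰⇒> (free ∘ forces χ)

pairs-C : ∀ n → suc n C 2 ≡ n + n C 2
pairs-C n = trans (sym (nCk+nC[k+1]≡[n+1]C[k+1] n 1)) (cong (_+ n C 2) (nC1≡n n))

-- Triangles: each edge coloured by its larger end.

module Triangle where

  rainbow-free : ∀ {N} → ¬ RainbowCopy (colourBy N _⊔_ ⊔-comm) (K 3)
  rainbow-free S = peak (≤-total (v 0F) (v 1F)) (≤-total (v 0F) (v 2F)) (≤-total (v 1F) (v 2F))
    where
    v : Fin 3 → ℕ
    v i = toℕ (vertex S i)

    -- The two edges at the largest vertex have the same colour.
    clash : ∀ {i j l} → i ≢ j → i ≢ l → j ≢ l → ¬ (v j ≤ v i × v l ≤ v i)
    clash {i} {j} {l} i≢j i≢l j≢l (j≤i , l≤i)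
      with rainbow S i≢j i≢l (trans (m≥n⇒m⊔n≡m j≤i) (sym (m≥n⇒m⊔n≡m l≤i)))
    ... | inj₁ (_ , j≡l) = j≢l j≡l
    ... | inj₂ (i≡l , _) = i≢l i≡l

    peak : v 0F ≤ v 1F ⊎ v 1F ≤ v 0F → v 0F ≤ v 2F ⊎ v 2F ≤ v 0F → v 1F ≤ v 2F ⊎ v 2F ≤ v 1F → _
    peak (inj₁ 0≤1) _          (inj₂ 2≤1) = clash {1F} {0F} {2F} (λ ()) (λ ()) (λ ()) (0≤1 , 2≤1)
    peak _          (inj₁ 0≤2) (inj₁ 1≤2) = clash {2F} {0F} {1F} (λ ()) (λ ()) (λ ()) (0≤2 , 1≤2)
    peak (inj₂ 1≤0) (inj₂ 2≤0) _          = clash {0F} {1F} {2F} (λ ()) (λ ()) (λ ()) (1≤0 , 2≤0)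
    -- The last two clauses are the cyclic comparisons, where all three values coincide.
    peak (inj₁ 0≤1) (inj₂ 2≤0) (inj₁ 1≤2) = clash {2F} {0F} {1F} (λ ()) (λ ()) (λ ()) (≤-trans 0≤1 1≤2 , 1≤2)
    peak (inj₂ 1≤0) (inj₁ 0≤2) (inj₂ 2≤1) = clash {1F} {0F} {2F} (λ ()) (λ ()) (λ ()) (≤-trans 0≤2 2≤1 , 2≤1)

  -- The edges at vertex 0 show the N colours 1, ..., N, and there is no rainbow triangle.
  rb-≥ : ∀ {N rb} → ForcesRainbow (K (suc N)) (K 3) rb → suc N ≤ rb
  rb-≥ {N} forces = ≤-<-trans (subst (_≤ c χ) (trans (length-map suc (upTo N)) (length-upTo N))
      (colourBy-c (suc N) _⊔_ ⊔-comm (Unique.map⁺ suc-injective (Unique.upTo⁺ N)) used))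
      (rainbow-free⇒< χ forces rainbow-free)
    where
    χ = colourBy (suc N) _⊔_ ⊔-comm
    used : ∀ {κ} → κ ∈ map suc (upTo N) → ∃[ i ] ∃[ j ] i < j × j < suc N × i ⊔ j ≡ κ
    used κ∈ with ∈-map⁻ suc κ∈
    ... | j , j∈ , refl = 0 , suc j , s≤s z≤n , s≤s (∈-upTo⁻ j∈) , refl

  -- With g n = n - 1 the increment at n ≥ 1 is n + 1: the binomial coefficient gains n, and the
  -- bound for rb gains 1.
  threshold-≡ : ∀ n → threshold 1 (_∸ 1) (suc n) ≡ suc n C 2 + suc n
  threshold-≡ zero    = refl
  threshold-≡ (suc n) = trans (cong₂ _+_ (threshold-≡ n) (cong (suc n +_) (trans (+-∸-assoc 1 {n} ≤-refl) (cong suc (n∸n≡0 n)))))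
    (trans (regroup (suc n C 2) (suc n)) (cong (_+ (2 + n)) (sym (pairs-C (suc n)))))
    where
    regroup : ∀ a b → a + b + (b + 1) ≡ b + a + suc b
    regroup = solve-∀

  cases : ∀ n → pairs (suc n) < threshold 1 (_∸ 1) (suc n) ⊎
                (1 * (n ∸ 1) < n ⊎ (∃[ p′ ] 0 ≡ suc p′ × 2 ≤ n ∸ 1 × 1 * (n ∸ 1) ≤ n))
  cases zero    = inj₁ (s≤s z≤n)
  cases (suc n) = inj₂ (inj₁ (s≤s (≤-reflexive (+-identityʳ n))))

-- Larger cliques: the Turán colouring with p = k - 2 classes.

module Turán (q : ℕ) where

  p : ℕ
  p = 2 + q

  module _ (N : ℕ) where

    -- The classes are the residues modulo `p`. Edges inside classes share colour 0; an edge i < j <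
    -- N between classes gets a positive code from which j and i are recovered by division by N.
    turán : ℕ → ℕ → ℕ
    turán i j with i % p ℕ.≟ j % p
    ... | yes _ = 0
    ... | no  _ = suc ((i ⊔ j) * N + (i ⊓ j))

    turán-sym : ∀ i j → turán i j ≡ turán j i
    turán-sym i j with i % p ℕ.≟ j % p | j % p ℕ.≟ i % p
    ... | yes _ | yes _  = refl
    ... | no  _ | no  _  = cong suc (cong₂ (λ a b → a * N + b) (⊔-comm i j) (⊓-comm i j))
    ... | yes eq | no neq = contradiction (sym eq) neq
    ... | no neq | yes eq = contradiction (sym eq) neq

    turán-same : ∀ {i j} → i % p ≡ j % p → turán i j ≡ 0
    turán-same {i} {j} eq with i % p ℕ.≟ j % p
    ... | yes _  = refl
    ... | no neq = contradiction eq neq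

    turán-cross : ∀ {i j} → i < j → i % p ≢ j % p → turán i j ≡ suc (j * N + i)
    turán-cross {i} {j} i<j neq with i % p ℕ.≟ j % p
    ... | yes eq = contradiction eq neq
    ... | no  _  = cong suc (cong₂ (λ a b → a * N + b) (m≤n⇒m⊔n≡n (<⇒≤ i<j)) (m≤n⇒m⊓n≡m (<⇒≤ i<j)))

    χ : Colouring (K N)
    χ = colourBy N turán turán-sym

    class : Fin N → Fin p
    class u = fromℕ< (m%n<n (toℕ u) p)

    -- Among p + 2 vertices some two share a class, and after removing one of
    -- them so do another two: both pairs have colour 0.
    rainbow-free : ¬ RainbowCopy χ (K (2 + p))
    rainbow-free S with pigeonhole (m<n⇒m<1+n (n<1+n p)) (class ∘ vertex S)
    ... | i , j , i<j , eq with pigeonhole (n<1+n p) (class ∘ vertex S ∘ punchIn j)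
    ... | i′ , j′ , i′<j′ , eq′
      with rainbow S (<F⇒≢ i<j) (<F⇒≢ i′<j′ ∘ punchIn-injective j i′ j′)
             (trans (turán-same (fromℕ<-injective _ _ _ _ eq))
                    (sym (turán-same (fromℕ<-injective _ _ _ _ eq′))))
    ... | inj₁ (_ , j≡) = punchInᵢ≢i j j′ (sym j≡)
    ... | inj₂ (_ , j≡) = punchInᵢ≢i j i′ (sym j≡)

    row : ℕ → List ℕ
    row j = filter (∁? (λ i → i % p ℕ.≟ j % p)) (upTo j)

    -- For n ≤ N the length of `codes n` is the number of edges of the Turán graph on the vertices
    -- below n.
    codes : ℕ → List ℕ
    codes zero    = []
    codes (suc j) = map (λ i → suc (j * N + i)) (row j) ++ codes j

    ∈-row : ∀ {i j} → i ∈ row j → i < j × i % p ≢ j % p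
    ∈-row {j = j} i∈ = let i∈′ , neq = ∈-filter⁻ (∁? (λ i → i % p ℕ.≟ j % p)) {xs = upTo j} i∈ in ∈-upTo⁻ i∈′ , neq

    ∈-codes : ∀ {n κ} → κ ∈ codes n → ∃[ i ] ∃[ j ] i < j × j < n × i % p ≢ j % p × κ ≡ suc (j * N + i)
    ∈-codes {suc n} κ∈ with ∈-++⁻ (map (λ i → suc (n * N + i)) (row n)) κ∈
    ... | inj₂ κ∈′ with ∈-codes κ∈′
    ...   | i , j , i<j , j<n , rest = i , j , i<j , m<n⇒m<1+n j<n , rest
    ∈-codes {suc n} κ∈ | inj₁ κ∈′ with ∈-map⁻ (λ i → suc (n * N + i)) κ∈′
    ...   | i , i∈ , eq = let i<n , neq = ∈-row i∈ in i , n , i<n , n<1+n n , neq , eq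

    -- Up to the common successor, row n has codes from n N on, while an earlier row j stays below
    -- (j + 1) N ≤ n N.
    codes! : ∀ {n} → n ≤ N → Unique (codes n)
    codes! {zero}  _   = []
    codes! {suc n} n<N = Unique.++⁺
      (Unique.map⁺ (+-cancelˡ-≡ (n * N) _ _ ∘ suc-injective)
        (Unique.filter⁺ (∁? (λ i → i % p ℕ.≟ n % p)) (Unique.upTo⁺ n)))
      (codes! (<⇒≤ n<N)) disjoint
      where
      open ≤-Reasoning
      disjoint : ∀ {κ} → ¬ (κ ∈ map (λ i → suc (n * N + i)) (row n) × κ ∈ codes n)
      disjoint (κ∈ , κ∈′) with ∈-map⁻ (λ i → suc (n * N + i)) κ∈ | ∈-codes κ∈′
      ... | i , _ , eq | i′ , j , i′<j , j<n , _ , eq′ = <⇒≢ (begin-strict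
        j * N + i′   <⟨ +-monoʳ-< (j * N) (<-trans i′<j (<-trans j<n n<N)) ⟩
        j * N + N    ≡⟨ +-comm (j * N) N ⟩
        suc j * N    ≤⟨ *-monoˡ-≤ N j<n ⟩
        n * N        ≤⟨ m≤m+n (n * N) i ⟩
        n * N + i    ∎) (suc-injective (trans (sym eq′) eq))

    -- The i < j in the class of j are among the numbers j % p + t p with t < j / p.
    length-row : ∀ j → j ∸ j / p ≤ length (row j)
    length-row j = m≤n+o⇒m∸n≤o j (j / p) (begin
      j                                   ≡⟨ length-upTo j ⟨
      length (upTo j)                     ≡⟨ length-filter-∁ same? (upTo j) ⟨
      length (filter same? (upTo j)) + length (row j)
        ≤⟨ +-monoˡ-≤ (length (row j)) (Unique-⊆⇒length≤ (Unique.filter⁺ same? (Unique.upTo⁺ j)) progression) ⟩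
      length (map (λ t → j % p + t * p) (upTo (j / p))) + length (row j)
        ≡⟨ cong (_+ length (row j)) (trans (length-map (λ t → j % p + t * p) (upTo (j / p))) (length-upTo (j / p))) ⟩
      j / p + length (row j)              ∎)
      where
      open ≤-Reasoning
      same? = λ i → i % p ℕ.≟ j % p
      progression : filter same? (upTo j) ⊆ map (λ t → j % p + t * p) (upTo (j / p))
      progression {i} i∈ with ∈-filter⁻ same? {xs = upTo j} i∈
      ... | i∈′ , eq = subst (_∈ map (λ t → j % p + t * p) (upTo (j / p)))
            (trans (cong (_+ i / p * p) (sym eq)) (sym (m≡m%n+[m/n]*n i p)))
            (∈-map⁺ (λ t → j % p + t * p) (∈-upTo⁺ (*-cancelʳ-< p (i / p) (j / p) (+-cancelˡ-< (j % p) _ _ (begin-strict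
              j % p + i / p * p   ≡⟨ cong (_+ i / p * p) eq ⟨
              i % p + i / p * p   ≡⟨ m≡m%n+[m/n]*n i p ⟨
              i                   <⟨ ∈-upTo⁻ i∈′ ⟩
              j                   ≡⟨ m≡m%n+[m/n]*n j p ⟩
              j % p + j / p * p   ∎)))))

    -- At vertex n the binomial coefficient gains n and `codes` gains at least n - n / p, which
    -- together cover the increment.
    threshold-≤ : ∀ n → threshold 2 (_/ p) n ≤ n C 2 + (2 + length (codes n))
    threshold-≤ zero    = ≤-refl
    threshold-≤ (suc n) = begin
      threshold 2 (_/ p) n + (n + (n ∸ n / p))
        ≤⟨ +-mono-≤ (threshold-≤ n) (+-monoʳ-≤ n (length-row n)) ⟩
      n C 2 + (2 + length (codes n)) + (n + length (row n))
        ≡⟨ regroup (n C 2) (length (codes n)) n (length (row n)) ⟩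
      n + n C 2 + (2 + (length (row n) + length (codes n)))
        ≡⟨ cong₂ _+_ (pairs-C n) (cong (2 +_) (trans (length-++ (map (λ i → suc (n * N + i)) (row n)))
             (cong (_+ length (codes n)) (length-map (λ i → suc (n * N + i)) (row n))))) ⟨
      suc n C 2 + (2 + length (codes (suc n))) ∎
      where
      open ≤-Reasoning
      regroup : ∀ a b c d → a + (2 + b) + (c + d) ≡ c + a + (2 + (d + b))
      regroup = solve-∀

    -- The 2 consists of colour 0 and of the strict inequality for a rainbow-free colouring.
    rb-≥ : ∀ {rb} → p < N → ForcesRainbow (K N) (K (2 + p)) rb → 2 + length (codes N) ≤ rb
    rb-≥ p<N forces = ≤-<-trans (colourBy-c N turán turán-sym
        (All.tabulate (λ κ∈ 0≡κ → let _ , _ , _ , _ , _ , eq = ∈-codes {N} κ∈ in 0≢1+n (trans 0≡κ eq)) ∷ codes! ≤-refl) used)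
        (rainbow-free⇒< χ forces rainbow-free)
      where
      used : ∀ {κ} → κ ∈ 0 ∷ codes N → ∃[ i ] ∃[ j ] i < j × j < N × turán i j ≡ κ
      -- Colour 0 occurs because p < N: the vertices 0 and p share a class.
      used (here refl) = 0 , p , s≤s z≤n , p<N , turán-same {0} {p} (sym (n%n≡0 p))
      used (there κ∈) with ∈-codes κ∈
      ... | i , j , i<j , j<N , neq , eq = i , j , i<j , j<N , trans (turán-cross i<j neq) (sym eq)

  threshold-small : ∀ {n} → n ≤ p → threshold 2 (_/ p) n ≡ 2 + pairs n
  threshold-small {zero}  _   = refl
  threshold-small {suc n} n<p = cong₂ (λ a b → a + (n + (n ∸ b))) (threshold-small (<⇒≤ n<p)) (m<n⇒m/n≡0 n<p)

  -- For n ≤ p the start value 2 outweighs the loss n / p ≤ 1, so the threshold is out of reach. For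
  -- n > p the loose alternative holds unless p divides n, and then n / p ≥ 2.
  cases : ∀ n → pairs (suc n) < threshold 2 (_/ p) (suc n) ⊎
                (p * (n / p) < n ⊎ (∃[ q′ ] suc q ≡ suc q′ × 2 ≤ n / p × p * (n / p) ≤ n))
  cases n with n ≤? p
  ... | yes n≤p = inj₁ (begin-strict
    pairs n + (n + n)                          ≤⟨ +-monoʳ-≤ (pairs n) (+-monoʳ-≤ n (m≤n+m∸n n 1)) ⟩
    pairs n + (n + (1 + (n ∸ 1)))              <⟨ n<1+n _ ⟩
    1 + (pairs n + (n + (1 + (n ∸ 1))))        ≡⟨ regroup (pairs n) n (n ∸ 1) ⟩
    2 + pairs n + (n + (n ∸ 1))                ≤⟨ +-monoʳ-≤ (2 + pairs n) (+-monoʳ-≤ n (∸-monoʳ-≤ n n/p≤1)) ⟩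
    2 + pairs n + (n + (n ∸ n / p))            ≡⟨ cong (_+ (n + (n ∸ n / p))) (threshold-small n≤p) ⟨
    threshold 2 (_/ p) (suc n)                 ∎)
    where
    open ≤-Reasoning
    n/p≤1 : n / p ≤ 1
    n/p≤1 = ≤-trans (/-monoˡ-≤ p n≤p) (≤-reflexive (n/n≡1 p))
    regroup : ∀ a b c → 1 + (a + (b + (1 + c))) ≡ 2 + a + (b + c)
    regroup = solve-∀
  ... | no n≰p with p * (n / p) ℕ.<? n
  ...   | yes lt = inj₂ (inj₁ lt)
  ...   | no ¬lt = inj₂ (inj₂ (q , refl , ≰⇒> (λ n/p≤1 → n≰p (begin
    n             ≤⟨ ≮⇒≥ ¬lt ⟩
    p * (n / p)   ≤⟨ *-monoʳ-≤ p n/p≤1 ⟩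
    p * 1         ≡⟨ *-identityʳ p ⟩
    p             ∎)) , ≤-trans (≤-reflexive (*-comm p (n / p))) (m/n*n≤m n p)))
    where open ≤-Reasoning

-- Arithmetic of deleting s vertices.

pairs+n : ∀ n → pairs n + n ≡ n * n
pairs+n zero    = refl
pairs+n (suc n) = trans (regroup (pairs n) n) (trans (cong (λ t → t + n + suc n) (pairs+n n)) (square n))
  where
  regroup : ∀ a b → a + (b + b) + suc b ≡ a + b + b + suc b
  regroup = solve-∀
  square : ∀ n → n * n + n + suc n ≡ suc n * suc n
  square = solve-∀

-- For n = N + s this is pairs n - pairs N = s (2 n - 1) - s², the most weight that s deleted
-- vertices can carry. Adding n to both sides reduces it to n² + s² = N² + 2 s n.
pairs-drop : ∀ N s → 1 ≤ N + s → pairs (N + s) + s * s ≡ pairs N + s * (2 * (N + s) ∸ 1)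
pairs-drop N s (1≤n) = +-cancelʳ-≡ n _ _ (begin-equality
  pairs n + s * s + n                          ≡⟨ swap₁ (pairs n) (s * s) n ⟩
  pairs n + n + s * s                          ≡⟨ cong (_+ s * s) (pairs+n n) ⟩
  n * n + s * s                                ≡⟨ square N s ⟩
  N * N + s * (2 * n)                          ≡⟨ cong₂ _+_ (pairs+n N) (cong (s *_) (m+[n∸m]≡n (≤-trans 1≤n (m≤m+n n (n + 0))))) ⟨
  pairs N + N + s * (1 + (2 * n ∸ 1))          ≡⟨ swap₂ (pairs N) N s (2 * n ∸ 1) ⟩
  pairs N + s * (2 * n ∸ 1) + n                ∎)
  where
  open ≤-Reasoning
  n = N + s
  swap₁ : ∀ a b c → a + b + c ≡ a + c + b
  swap₁ = solve-∀
  square : ∀ N s → (N + s) * (N + s) + s * s ≡ N * N + s * (2 * (N + s))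
  square = solve-∀
  swap₂ : ∀ a b c d → a + b + c * (1 + d) ≡ a + c * d + (b + c)
  swap₂ = solve-∀

filter-partition-↭ : ∀ {A : Set} {P : U.Pred A 0ℓ} (P? : U.Decidable P) xs →
                     xs ↭ filter P? xs ++ filter (∁? P?) xs
filter-partition-↭ P? [] = ↭-refl
filter-partition-↭ P? (x ∷ xs) with P? x
... | yes _ = prep x (filter-partition-↭ P? xs)
... | no  _ = ↭-trans (prep x (filter-partition-↭ P? xs)) (↭-sym (shift x (filter P? xs) (filter (∁? P?) xs)))

-- Vertex-disjoint rainbow cliques.

module _ {n} {G : Graph n} (χ : Colouring G) where

  open ColourMatrix (matrix χ) (matrix-sym χ) (matrix-irrefl χ)

  -- Replacing `rb` by its lower bound, from `Triangle` for k = 3 and from `Turán` for k ≥ 4, brings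
  -- the weight above the threshold of the induction.
  weight⇒rainbow-clique : ∀ {N rb} p → 3 + p ≤ N → ForcesRainbow (K N) (K (3 + p)) rb →
    ∀ {S} → Unique S → length S ≡ N → N C 2 + rb ≤ weight S → Clique (3 + p) S
  weight⇒rainbow-clique {suc N} zero _ forces S! len le =
    weight⇒clique (s≤s z≤n) Triangle.cases (suc N) len S!
      (≤-trans (≤-reflexive (Triangle.threshold-≡ N))
        (≤-trans (+-monoʳ-≤ (suc N C 2) (Triangle.rb-≥ forces)) le))
  weight⇒rainbow-clique {N} (suc q) k≤N forces S! len le =
    weight⇒clique (s≤s z≤n) (Turán.cases q) N len S!
      (≤-trans (Turán.threshold-≤ q N N)
        (≤-trans (+-monoʳ-≤ (N C 2) (Turán.rb-≥ q N (≤-trans (n≤1+n _) k≤N) forces)) le))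

  clique-avoiding : ∀ {p N s rb} → n ≡ N + s → 3 + p ≤ N → ForcesRainbow (K N) (K (3 + p)) rb →
    N C 2 + rb + s * (2 * n ∸ 1) ∸ s * s ≤ e G + c χ →
    ∀ D → length D ≤ s → Clique (3 + p) (filter (∁? (λ u → _∈?_ _≟_ u D)) (allFin n))
  clique-avoiding {p} {N} {s} {rb} refl k≤N forces le D D≤s =
    Clique-⊆ (λ u∈ → subst (_ ∈_) (take++drop≡id (length T ∸ N) T) (∈-++⁺ʳ R u∈))
      (weight⇒rainbow-clique p k≤N forces (Unique.drop⁺ (length T ∸ N) T!) S-length S-weight)
    where
    open ≤-Reasoning
    n′ = N + s
    V′ = allFin n′
    in-D? = λ u → _∈?_ _≟_ u D
    A = filter in-D? V′
    T = filter (∁? in-D?) V′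
    -- D may cover fewer than s vertices; deleting R as well leaves exactly N, the order for which
    -- `forces` speaks.
    R = take (length T ∸ N) T
    S = drop (length T ∸ N) T
    A! = Unique.filter⁺ in-D? (Unique.allFin⁺ n′)
    T! = Unique.filter⁺ (∁? in-D?) (Unique.allFin⁺ n′)

    T-length : N ≤ length T
    T-length = +-cancelʳ-≤ s _ _ (begin
      N + s                ≡⟨ length-tabulate {n = n′} id ⟨
      length V′            ≡⟨ length-filter-∁ in-D? V′ ⟨
      length A + length T  ≤⟨ +-monoˡ-≤ (length T) (≤-trans
                                (Unique-⊆⇒length≤ A! (λ u∈ → proj₂ (∈-filter⁻ in-D? {xs = V′} u∈))) D≤s) ⟩
      s + length T         ≡⟨ +-comm s (length T) ⟩
      length T + s         ∎)

    S-length : length S ≡ N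
    S-length = trans (length-drop (length T ∸ N) T) (m∸[m∸n]≡n T-length)

    AR++S≡ : (A ++ R) ++ S ≡ A ++ T
    AR++S≡ = trans (++-assoc A R S) (cong (A ++_) (take++drop≡id (length T ∸ N) T))

    all-↭ : V′ ↭ (A ++ R) ++ S
    all-↭ = subst (V′ ↭_) (sym AR++S≡) (filter-partition-↭ in-D? V′)

    all! : Unique ((A ++ R) ++ S)
    all! = subst Unique (sym AR++S≡) (Unique.++⁺ A! T! λ (u∈A , u∈T) →
      proj₂ (∈-filter⁻ (∁? in-D?) {xs = V′} u∈T) (proj₂ (∈-filter⁻ in-D? {xs = V′} u∈A)))

    removal : weight V′ + pairs N ≤ weight S + pairs n′
    removal = begin
      weight V′ + pairs N                         ≤⟨ +-monoˡ-≤ (pairs N) (weight-↭ all-↭) ⟩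
      weight ((A ++ R) ++ S) + pairs N            ≡⟨ cong (λ l → weight ((A ++ R) ++ S) + pairs l) S-length ⟨
      weight ((A ++ R) ++ S) + pairs (length S)   ≤⟨ weight-++ (A ++ R) all! ⟩
      weight S + pairs (length ((A ++ R) ++ S))
        ≡⟨ cong (λ l → weight S + pairs l) (trans (sym (↭-length all-↭)) (length-tabulate {n = n′} id)) ⟩
      weight S + pairs n′                         ∎

    Q = s * (2 * n′ ∸ 1)

    S-weight : N C 2 + rb ≤ weight S
    S-weight = +-cancelʳ-≤ (Q + pairs N) _ _ (begin
      N C 2 + rb + (Q + pairs N)            ≡⟨ +-assoc (N C 2 + rb) Q (pairs N) ⟨
      -- The subtraction of s² may be truncated: a ≤ s² + (a ∸ s²) holds in any case.
      N C 2 + rb + Q + pairs N              ≤⟨ +-monoˡ-≤ (pairs N) (m≤n+m∸n (N C 2 + rb + Q) (s * s)) ⟩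
      s * s + (N C 2 + rb + Q ∸ s * s) + pairs N
        ≤⟨ +-monoˡ-≤ (pairs N) (+-monoʳ-≤ (s * s) (≤-trans le (+-mono-≤ (e≤edgeCount χ) (c≤colourCount χ)))) ⟩
      s * s + weight V′ + pairs N           ≡⟨ +-assoc (s * s) (weight V′) (pairs N) ⟩
      s * s + (weight V′ + pairs N)         ≤⟨ +-monoʳ-≤ (s * s) removal ⟩
      s * s + (weight S + pairs n′)         ≡⟨ regroup (s * s) (weight S) (pairs n′) ⟩
      weight S + (pairs n′ + s * s)         ≡⟨ cong (weight S +_) (trans
        (pairs-drop N s (≤-trans (s≤s z≤n) (≤-trans k≤N (m≤m+n N s)))) (+-comm (pairs N) Q)) ⟩
      weight S + (Q + pairs N)              ∎)
      where
      regroup : ∀ a b c → a + (b + c) ≡ b + (c + a)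
      regroup = solve-∀

  record Copies (h m : ℕ) : Set where
    field
      copy        : Fin m → RainbowCopy χ (K h)
      disjoint    : ∀ i j → i ≢ j → VertexDisjoint (copy i) (copy j)
      used        : List (Fin n)
      used-length : length used ≡ m * h
      used-∈      : ∀ i a → vertex (copy i) a ∈ used

  -- A new copy has to avoid the earlier ones only, so all copies together may have h more vertices
  -- than the budget s.
  greedy : ∀ {h s} →
    (∀ D → length D ≤ s → Clique h (filter (∁? (λ u → _∈?_ _≟_ u D)) (allFin n))) →
    ∀ m → m * h ≤ s + h → Copies h m
  greedy find-clique zero _ = record
    { copy = λ () ; disjoint = λ () ; used = [] ; used-length = refl ; used-∈ = λ () }
  greedy {h} {s} find-clique (suc m) le = record
    { copy = copy′ ; disjoint = disjoint′ ; used = tabulate at ++ used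
    ; used-length = trans (length-++ (tabulate at)) (cong₂ _+_ (length-tabulate at) used-length)
    ; used-∈ = used-∈′ }
    where
    mh≤s : m * h ≤ s
    mh≤s = +-cancelʳ-≤ h _ _ (≤-trans (≤-reflexive (+-comm (m * h) h)) le)
    open Copies (greedy find-clique m (≤-trans mh≤s (m≤m+n s h)))
    Q = find-clique used (subst (_≤ s) (sym used-length) mh≤s)
    open Clique Q using (at; at-∈)

    fresh : ∀ a → at a ∉ used
    fresh a = proj₂ (∈-filter⁻ (∁? (λ u → _∈?_ _≟_ u used)) {xs = allFin n} (at-∈ a))

    copy′ : Fin (suc m) → RainbowCopy χ (K h)
    copy′ zero    = clique⇒copy χ Q
    copy′ (suc i) = copy i

    disjoint′ : ∀ i j → i ≢ j → VertexDisjoint (copy′ i) (copy′ j)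
    disjoint′ zero    zero    i≢j a b eq = i≢j refl
    disjoint′ zero    (suc j) _   a b eq = fresh a (subst (_∈ used) (sym eq) (used-∈ j b))
    disjoint′ (suc i) zero    _   a b eq = fresh b (subst (_∈ used) eq (used-∈ i a))
    disjoint′ (suc i) (suc j) i≢j = disjoint i j (i≢j ∘ cong suc)

    used-∈′ : ∀ i a → vertex (copy′ i) a ∈ tabulate at ++ used
    used-∈′ zero    a = ∈-++⁺ˡ (∈-tabulate⁺ a)
    used-∈′ (suc i) a = ∈-++⁺ʳ (tabulate at) (used-∈ i a)

^2-* : ∀ k m → k ^ 2 * m ^ 2 ≡ k * m * (k * m)
^2-* = lemma
  where
  lemma : ∀ k m → k * (k * 1) * (m * (m * 1)) ≡ k * m * (k * m)
  lemma = solve-∀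

proposition1p5 : ∀ (k m n : ℕ) → k ≥ 3 → m ≥ 1 → n ≥ k * m →
    (G : Graph n) (χ : Colouring G) →
    (rb : ℕ) → IsRb (K (n ∸ k * (m ∸ 1))) (K k) rb →
    e G + c χ ≥ ((n ∸ k * (m ∸ 1)) C 2) + rb + k * (m ∸ 1) * (2 * n ∸ 1) ∸ k ^ 2 * (m ∸ 1) ^ 2 →
    Σ[ S ∈ (Fin m → RainbowCopy χ (K k)) ] (∀ (i j : Fin m) → i ≢ j → VertexDisjoint (S i) (S j))
proposition1p5 (suc (suc (suc p))) (suc m) n (s≤s (s≤s (s≤s z≤n))) (s≤s z≤n) n≥km G χ rb (forces , _) bound = copy , disjoint
  where
  -- After the match `m` is one less than the number of copies, so s counts the vertices of all
  -- copies but the last.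
  k s : ℕ
  k = 3 + p
  s = k * m

  km≡ : k * suc m ≡ k + s
  km≡ = *-suc k m

  open Copies (greedy χ
    (clique-avoiding χ {s = s} (sym (m∸n+n≡m (≤-trans (m≤n+m s k) (subst (_≤ n) km≡ n≥km))))
      (m+n≤o⇒m≤o∸n k (subst (_≤ n) km≡ n≥km)) forces
      (subst (λ t → (n ∸ s) C 2 + rb + s * (2 * n ∸ 1) ∸ t ≤ e G + c χ) (^2-* k m) bound))
    (suc m) (≤-reflexive (trans (*-comm (suc m) k) (trans km≡ (+-comm k s)))))
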